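{- Let $G$ be a connected finite simple graph with vertex set $[n]$. Then the connected subgraph arrangement $\mathcal{A}_G$ in $\mathbb{Q}^n$ is projectively unique: for every hyperplane arrangement $\mathcal{C}$ in $\mathbb{Q}^n$ whose intersection lattice $L(\mathcal{C})$ is isomorphic as a poset to $L(\mathcal{A}_G)$, there exists $\varphi\in \mathrm{GL}(\mathbb{Q}^n)$ with $\mathcal{C}=\{\varphi(H)\mid H\in\mathcal{A}_G\}$.
   Context: Let $G=(N,E)$ be a finite simple graph with vertex set $N=[n]=\{1,\dots,n\}$. For $\varnothing\neq I\subseteq N$, $G[I]$ denotes the induced subgraph on $I$, and $H_I:=\ker\big(\sum_{i\in I}x_i\big)$, where $x_1,\dots,x_n$ are the coordinate functions on $\mathbb{K}^n$ for a field $\mathbb{K}$. The connected subgraph arrangement is $\mathcal{A}_G(\mathbb{K}):=\{H_I\mid \varnothing\neq I\subseteq N,\ G[I]\text{ connected}\}$, a central hyperplane arrangement in $\mathbb{K}^n$; $\mathcal{A}_G:=\mathcal{A}_G(\mathbb{Q})$. The intersection lattice $L(\mathcal{A})$ of an arrangement is the set of all intersections of subsets of $\mathcal{A}$ (including $V$ itself), ordered by reverse inclusion. -}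

module Defs where

open import Algebra.Module.Bundles.Raw using (RawLeftModule)
open import Algebra.Module.Morphism.Structures using (module LeftModuleMorphisms)
open import Data.Bool.Base using (if_then_else_)
open import Data.Fin.Base using (Fin)
open import Data.Fin.Properties as Fin using ()
open import Data.Fin.Subset using (Subset; inside; outside; _∈_; Nonempty)
open import Data.Fin.Subset.Properties using (_∈?_)
open import Data.List.Base using (List; []; _∷_; _++_; map; allFin)
open import Data.List.Membership.Propositional using () renaming (_∈_ to _∈ˡ_)
open import Data.List.Membership.Propositional.Properties
  using (∈-allFin; ∈-map⁺; ∈-map⁻; ∈-++⁺ˡ; ∈-++⁺ʳ)
open import Data.List.Relation.Binary.Subset.Propositional using () renaming (_⊆_ to _⊆ˡ_)
open import Data.List.Relation.Unary.All as All using (All)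
open import Data.List.Relation.Unary.Any using (here; there)
open import Data.Nat.Base using (ℕ; zero; suc)
open import Data.Product.Base using (Σ; ∃; ∃-syntax; _×_; _,_; proj₁; proj₂)
open import Data.Rational.Base using (ℚ; 0ℚ; 1ℚ; _+_; _*_; -_)
open import Data.Rational.Properties using (1≢0)
open import Data.Sum.Base using (_⊎_; inj₁; inj₂; [_,_]′)
open import Data.Vec.Base as Vec using (Vec; []; _∷_; zipWith; replicate)
open import Data.Vec.Properties using ([]=⇒lookup; lookup-map; lookup-replicate)
open import Data.Vec.Properties.WithK using ([]=-irrelevant)
open import Function.Base using (_∘_)
open import Level using (0ℓ) renaming (suc to lsuc)
open import Relation.Binary.Bundles using (Poset)
open import Relation.Binary.Construct.Closure.ReflexiveTransitive using (Star; ε; _◅_; _◅◅_)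
open import Relation.Binary.Core using (Rel)
open import Relation.Binary.Definitions
  using (DecidableEquality; Irreflexive; Symmetric) renaming (Decidable to Decidable₂)
open import Relation.Binary.Morphism.Structures using (IsOrderIsomorphism)
open import Relation.Binary.PropositionalEquality
  using (_≡_; _≢_; refl; sym; trans; cong)
open import Relation.Nullary.Decidable using (Dec; yes; no; map′; _×-dec_; _⊎-dec_)
open import Relation.Nullary.Negation using (contradiction)
open import Relation.Unary using (Pred; Decidable; _⊆_; _≐_)

-- The list analogue of { x ∈ xs | P x }, keeping the proofs of P.
select : ∀ {A : Set} {P : Pred A 0ℓ} → Decidable P → List A → List (∃ P)
select P? []       = []
select P? (x ∷ xs) with P? x
... | yes px = (x , px) ∷ select P? xs
... | no  _  = select P? xs

∈-select : ∀ {A : Set} {P : Pred A 0ℓ} (P? : Decidable P) {x} {xs : List A} →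
           x ∈ˡ xs → P x → ∃[ px ] (x , px) ∈ˡ select P? xs
∈-select P? {x} (here refl) p with P? x
... | yes px = px , here refl
... | no ¬px = contradiction p ¬px
∈-select P? {xs = y ∷ _} (there x∈xs) p with P? y | ∈-select P? x∈xs p
... | yes _ | px , i = px , there i
... | no  _ | px , i = px , i

subsets : ∀ n → List (Subset n)
subsets zero    = [] ∷ []
subsets (suc n) = map (inside ∷_) (subsets n) ++ map (outside ∷_) (subsets n)

∈-subsets : ∀ {n} (I : Subset n) → I ∈ˡ subsets n
∈-subsets []            = here refl
∈-subsets (inside  ∷ I) = ∈-++⁺ˡ (∈-map⁺ (inside ∷_) (∈-subsets I))
∈-subsets (outside ∷ I) =
  ∈-++⁺ʳ (map (inside ∷_) (subsets _)) (∈-map⁺ (outside ∷_) (∈-subsets I))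

record Graph (V : Set) : Set₁ where
  infix 4 _~_ _~?_
  field
    _~_    : Rel V 0ℓ
    ~-sym  : Symmetric _~_
    ~-irr  : Irreflexive _≡_ _~_
    _~?_   : Decidable₂ _~_

_[_] : ∀ {n} → Graph (Fin n) → (I : Subset n) → Graph (∃ (_∈ I))
G [ I ] = record
  { _~_   = λ u v → proj₁ u ~ proj₁ v
  ; ~-sym = ~-sym
  ; ~-irr = λ u≡v → ~-irr (cong proj₁ u≡v)
  ; _~?_  = λ u v → proj₁ u ~? proj₁ v
  }
  where open Graph G

-- The graph without vertices does not count as connected.
Connected : ∀ {V} → Graph V → Set
Connected {V} G = V × (∀ (u v : V) → Star (Graph._~_ G) u v)

-- Connectedness of a finite graph is decided by Warshall's algorithm:
-- Walk vs u v holds if v can be reached from u by a walk all of whose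
-- intermediate vertices are in vs.
module _ {V : Set} (G : Graph V) (_≟_ : DecidableEquality V)
         (vs : List V) (complete : ∀ v → v ∈ˡ vs) where

  open Graph G

  private
    Walk : List V → Rel V 0ℓ
    Walk []       u v = u ≡ v ⊎ u ~ v
    Walk (w ∷ ws) u v = Walk ws u v ⊎ (Walk ws u w × Walk ws w v)

    walk? : ∀ ws → Decidable₂ (Walk ws)
    walk? []       u v = (u ≟ v) ⊎-dec (u ~? v)
    walk? (w ∷ ws) u v = walk? ws u v ⊎-dec (walk? ws u w ×-dec walk? ws w v)

    walk-base : ∀ ws {u v} → u ≡ v ⊎ u ~ v → Walk ws u v
    walk-base []       p = p
    walk-base (_ ∷ ws) p = inj₁ (walk-base ws p)

    walk-trans : ∀ {ws w u v} → w ∈ˡ ws → Walk ws u w → Walk ws w v → Walk ws u v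
    walk-trans (here refl) p q = inj₂ ([ (λ x → x) , proj₁ ]′ p , [ (λ x → x) , proj₂ ]′ q)
    walk-trans (there i) (inj₁ a)       (inj₁ b)       = inj₁ (walk-trans i a b)
    walk-trans (there i) (inj₁ a)       (inj₂ (b , c)) = inj₂ (walk-trans i a b , c)
    walk-trans (there i) (inj₂ (a , b)) (inj₁ c)       = inj₂ (a , walk-trans i b c)
    walk-trans (there i) (inj₂ (a , _)) (inj₂ (_ , d)) = inj₂ (a , d)

    walk⇒star : ∀ ws {u v} → Walk ws u v → Star _~_ u v
    walk⇒star []       (inj₁ refl)    = ε
    walk⇒star []       (inj₂ e)       = e ◅ ε
    walk⇒star (_ ∷ ws) (inj₁ p)       = walk⇒star ws p
    walk⇒star (_ ∷ ws) (inj₂ (p , q)) = walk⇒star ws p ◅◅ walk⇒star ws q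

    star⇒walk : ∀ {u v} → Star _~_ u v → Walk vs u v
    star⇒walk ε        = walk-base vs (inj₁ refl)
    star⇒walk (e ◅ es) = walk-trans (complete _) (walk-base vs (inj₂ e)) (star⇒walk es)

    inhabited? : ∀ ws → (∀ v → v ∈ˡ ws) → Dec V
    inhabited? []      c = no λ v → contradiction (c v) λ ()
    inhabited? (v ∷ _) _ = yes v

  connected? : Dec (Connected G)
  connected? = inhabited? vs complete ×-dec
    map′ (λ a u v → All.lookup (All.lookup a (complete u)) (complete v))
         (λ f → All.universal (λ u → All.universal (f u) vs) vs)
         (All.all? (λ u → All.all? (λ v →
           map′ (walk⇒star vs) star⇒walk (walk? vs u v)) vs) vs)

connected[_]? : ∀ {n} (G : Graph (Fin n)) (I : Subset n) → Dec (Connected (G [ I ]))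
connected[_]? {n} G I = connected? (G [ I ]) _≟_ (select (_∈? I) (allFin n)) complete
  where
  Σ-≡ : {u v : ∃ (_∈ I)} → proj₁ u ≡ proj₁ v → u ≡ v
  Σ-≡ {_ , p} {_ , q} refl = cong (_ ,_) ([]=-irrelevant p q)

  _≟_ : DecidableEquality (∃ (_∈ I))
  u ≟ v = map′ Σ-≡ (cong proj₁) (proj₁ u Fin.≟ proj₁ v)

  complete : ∀ v → v ∈ˡ select (_∈? I) (allFin n)
  complete (i , p) with ∈-select (_∈? I) (∈-allFin i) p
  ... | q , m with []=-irrelevant p q
  ... | refl = m

ℚ^ : ℕ → RawLeftModule ℚ 0ℓ 0ℓ
ℚ^ n = record
  { Carrierᴹ = Vec ℚ n
  ; _≈ᴹ_     = _≡_
  ; _+ᴹ_     = zipWith _+_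
  ; _*ₗ_     = λ c → Vec.map (c *_)
  ; 0ᴹ       = replicate n 0ℚ
  ; -ᴹ_      = Vec.map (-_)
  }

GL : ℕ → Set
GL n = ∃ (LeftModuleMorphisms.IsLeftModuleIsomorphism (ℚ^ n) (ℚ^ n))

_·_ : ∀ {n} → Vec ℚ n → Vec ℚ n → ℚ
a · x = Vec.foldr _ _+_ 0ℚ (zipWith _*_ a x)

-- A linear hyperplane, presented as the kernel of the nonzero linear form
-- x ↦ normal · x.  Proportional normals present the same hyperplane, so
-- hyperplanes are only ever compared as sets of points, by ≐.
record Hyperplane (n : ℕ) : Set where
  field
    normal   : Vec ℚ n
    normal≢0 : normal ≢ replicate n 0ℚ

⟦_⟧ : ∀ {n} → Hyperplane n → Pred (Vec ℚ n) 0ℓ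
⟦ H ⟧ x = Hyperplane.normal H · x ≡ 0ℚ

-- A finite set of hyperplanes; order and repetitions are irrelevant.
Arrangement : ℕ → Set
Arrangement n = List (Hyperplane n)

⋂ : ∀ {n} → List (Hyperplane n) → Pred (Vec ℚ n) 0ℓ
⋂ S x = All (λ H → ⟦ H ⟧ x) S

image : ∀ {n} → GL n → Pred (Vec ℚ n) 0ℓ → Pred (Vec ℚ n) 0ℓ
image (φ , _) X y = ∃[ x ] X x × φ x ≡ y

-- C = { φ(H) | H ∈ A }.
_IsImageOf_Under_ : ∀ {n} → Arrangement n → Arrangement n → GL n → Set
C IsImageOf A Under φ =
    All (λ K → ∃[ H ] H ∈ˡ A × ⟦ K ⟧ ≐ image φ ⟦ H ⟧) C
  × All (λ H → ∃[ K ] K ∈ˡ C × ⟦ K ⟧ ≐ image φ ⟦ H ⟧) A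

-- A flat is the intersection of a subset of A.  Different subsets may
-- have the same intersection, so flats are compared by that intersection.
Flat : ∀ {n} → Arrangement n → Set
Flat A = ∃[ S ] S ⊆ˡ A

points : ∀ {n} {A : Arrangement n} → Flat A → Pred (Vec ℚ n) 0ℓ
points (S , _) = ⋂ S

L : ∀ {n} → Arrangement n → Poset 0ℓ 0ℓ 0ℓ
L A = record
  { Carrier        = Flat A
  ; _≈_            = λ X Y → points X ≐ points Y
  ; _≤_            = λ X Y → points Y ⊆ points X
  ; isPartialOrder = record
    { isPreorder = record
      { isEquivalence = record
        { refl  = (λ x → x) , (λ x → x)
        ; sym   = λ (f , g) → g , f
        ; trans = λ (f , g) (h , k) → h ∘ f , g ∘ k
        }
      ; reflexive     = proj₂
      ; trans         = λ f g → f ∘ g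
      }
    ; antisym    = λ f g → g , f
    }
  }

_≅_ : Poset 0ℓ 0ℓ 0ℓ → Poset 0ℓ 0ℓ 0ℓ → Set
P ≅ Q = ∃ (IsOrderIsomorphism P._≈_ Q._≈_ P._≤_ Q._≤_)
  where
  module P = Poset P
  module Q = Poset Q

ProjectivelyUnique : ∀ {n} → Arrangement n → Set
ProjectivelyUnique {n} A =
  (C : Arrangement n) → L C ≅ L A → Σ (GL n) λ φ → C IsImageOf A Under φ

-- indicator I · x is the sum of the coordinates xᵢ with i ∈ I.
indicator : ∀ {n} → Subset n → Vec ℚ n
indicator = Vec.map (λ b → if b then 1ℚ else 0ℚ)

H : ∀ {n} (I : Subset n) → Nonempty I → Hyperplane n
H {n} I (i , i∈I) = record
  { normal   = indicator I
  ; normal≢0 = λ eq → 1≢0 (trans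
      (sym (trans (lookup-map i _ I) (cong (if_then 1ℚ else 0ℚ) ([]=⇒lookup i∈I))))
      (trans (cong (λ v → Vec.lookup v i) eq) (lookup-replicate i 0ℚ)))
  }

-- The component proj₁ of Connected (G [ I ]) says that I is nonempty.
𝒜 : ∀ {n} → Graph (Fin n) → Arrangement n
𝒜 {n} G = map (λ (I , connected) → H I (proj₁ connected))
              (select connected[ G ]? (subsets n))

-- 𝒜-complete and 𝒜-sound: 𝒜 G = { H_I | I ≠ ∅, G[I] connected }.
𝒜-complete : ∀ {n} (G : Graph (Fin n)) (I : Subset n) (I≠∅ : Nonempty I) →
             Connected (G [ I ]) → H I I≠∅ ∈ˡ 𝒜 G
𝒜-complete G I I≠∅ c with ∈-select connected[ G ]? (∈-subsets I) c
... | _ , m = ∈-map⁺ (λ (I , connected) → H I (proj₁ connected)) m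

𝒜-sound : ∀ {n} (G : Graph (Fin n)) {K} → K ∈ˡ 𝒜 G →
          ∃[ I ] Σ (Nonempty I) λ I≠∅ → Connected (G [ I ]) × K ≡ H I I≠∅
𝒜-sound G K∈𝒜 with ∈-map⁻ (λ (I , connected) → H I (proj₁ connected)) K∈𝒜
... | (I , c) , _ , eq = I , proj₁ c , c , eq

{-# OPTIONS --safe #-}

-- Let β_I be a normal of the hyperplane of C that corresponds to H_I, let
-- α_I = Σ_{i∈I} x_i, and N = [n].  The lattice isomorphism preserves which
-- hyperplanes contain the intersection of which others.  Hence there are
-- points p_i on which all β_j with j ≠ i vanish but β_i does not; moreover
-- β_N(p_i) ≠ 0, since α_N and the α_j with j ≠ i determine α_i, and p_i can be
-- scaled so that β_N(p_i) = 1.  Now β_I(p_i) = 0 for i ∉ I, and β_I is a nonzero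
-- constant on the p_i with i ∈ I: α_I vanishes on the common kernel of α_N and
-- the α_j with j ∉ I, hence β_I vanishes on p_i − p_i′ for i, i′ ∈ I.  So
-- the linear map sending e_i to p_i carries H_I to the kernel of β_I; it is
-- injective because β_j(Σ x_i p_i) = x_j β_j(p_j).

module Submission where

open import Algebra.Bundles using (CommutativeRing)
import Algebra.Properties.Ring
import Algebra.Solver.Ring.NaturalCoefficients.Default
open import Algebra.Structures using (IsCommutativeRing)
open import Data.Bool.Base using (if_then_else_)
open import Data.Bool.Properties using (¬-not)
open import Data.Fin.Base using (Fin; zero; suc; punchIn; punchOut)
open import Data.Fin.Properties as Fin using (any?; punchIn-punchOut)
open import Data.Fin.Subset using (Subset; _∈_; _∉_; ⊤; ⁅_⁆)
open import Data.Fin.Subset.Properties using (_∈?_; ∈⊤; x∈⁅x⁆; x∈⁅y⁆⇒x≡y)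
open import Data.List.Base using (List; []; _∷_; map; filter; allFin)
open import Data.List.Membership.Propositional using () renaming (_∈_ to _∈ˡ_)
open import Data.List.Membership.Propositional.Properties
  using (∈-allFin; ∈-map⁻; ∈-filter⁺; ∈-filter⁻)
open import Data.List.Relation.Unary.All as All using (All; []; _∷_)
open import Data.List.Relation.Unary.All.Properties using (map⁺; map⁻)
open import Data.List.Relation.Unary.Any using (here)
open import Data.Nat.Base using (ℕ; zero; suc)
open import Data.Product.Base using (∃; ∃-syntax; Σ; _×_; _,_; proj₁; proj₂)
open import Data.Rational.Base using (ℚ)
import Data.Rational.Base as ℚ
import Data.Rational.Properties as ℚ
open import Data.Sum.Base using (_⊎_; inj₁; inj₂)
open import Data.Vec.Base as Vec using (Vec; []; _∷_; zipWith; replicate; lookup; head; tail; tabulate)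
open import Data.Vec.Properties using
  ( map-cong; []=⇒lookup; lookup⇒[]=; lookup-map; lookup-zipWith; lookup-replicate
  ; lookup∘tabulate)
open import Data.Vec.Properties.WithK using ([]=-irrelevant)
open import Data.Vec.Relation.Binary.Pointwise.Extensional using (ext; Pointwise-≡⇒≡)
open import Function.Base using (_∘_)
open import Level using (0ℓ)
open import Relation.Binary.Construct.Closure.ReflexiveTransitive using (Star; ε; gmap)
open import Relation.Binary.Definitions using (DecidableEquality)
open import Relation.Binary.Morphism.Structures using (IsOrderIsomorphism)
open import Relation.Binary.PropositionalEquality
  using (_≡_; _≢_; refl; sym; trans; cong; cong₂; subst; subst₂; module ≡-Reasoning)
open import Relation.Nullary.Decidable using (yes; no; ¬?; decidable-stable)
open import Relation.Nullary.Negation using (¬_; contradiction)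
open import Relation.Unary using (Pred; Decidable; _⊆_; _≐_)

open import Defs using
  ( Graph; Connected; _[_]; Hyperplane; ⟦_⟧; ⋂; Arrangement; Flat; points; L; _≅_
  ; GL; image; _IsImageOf_Under_; ProjectivelyUnique; H; 𝒜; 𝒜-complete; 𝒜-sound)

open ≡-Reasoning

-- Linear algebra over a discrete field

-- ℚ is kept abstract: its operations unfold to gcd computations, which makes
-- type checking infeasible.
record DiscreteField : Set₁ where
  infixl 6 _+_
  infixl 7 _*_
  infix  8 -_
  field
    F                 : Set
    _+_ _*_           : F → F → F
    -_                : F → F
    0# 1#             : F
    isCommutativeRing : IsCommutativeRing _≡_ _+_ _*_ -_ 0# 1#
    _≟_               : DecidableEquality F
    1≢0               : 1# ≢ 0#
    ≢0⇒invertible     : ∀ {a} → a ≢ 0# → ∃[ b ] b * a ≡ 1#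

vec-ext : ∀ {A : Set} {n} {x y : Vec A n} → (∀ i → lookup x i ≡ lookup y i) → x ≡ y
vec-ext eq = Pointwise-≡⇒≡ (ext eq)

module LinearAlgebra (𝕂 : DiscreteField) where

  open DiscreteField 𝕂
  open IsCommutativeRing isCommutativeRing
    using ( +-identityˡ; +-identityʳ; *-identityˡ; *-identityʳ; zeroˡ; zeroʳ; *-assoc; *-comm
          ; distribˡ; distribʳ; +-comm; -‿inverseʳ)

  commutativeRing : CommutativeRing _ _
  commutativeRing = record { isCommutativeRing = isCommutativeRing }

  open Algebra.Properties.Ring (CommutativeRing.ring commutativeRing)
    using (-‿distribˡ-*; -1*x≈-x; +-cancelʳ)
  open Algebra.Solver.Ring.NaturalCoefficients.Default
    (CommutativeRing.commutativeSemiring commutativeRing) using (solve; _:=_; _:+_; _:*_)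

  infixl 6 _+[_]_
  infix 8 _·_

  _·_ : ∀ {n} → Vec F n → Vec F n → F
  a · x = Vec.foldr _ _+_ 0# (zipWith _*_ a x)

  private variable
    m n : ℕ

  -- Cancellation in the field

  *-cancelˡ-≢0 : ∀ a {b c} → a ≢ 0# → a * b ≡ a * c → b ≡ c
  *-cancelˡ-≢0 a {b} {c} a≢0 eq with ≢0⇒invertible a≢0
  ... | i , ia≡1 = begin
    b            ≡⟨ expand b ⟩
    i * (a * b)  ≡⟨ cong (i *_) eq ⟩
    i * (a * c)  ≡⟨ expand c ⟨
    c            ∎
    where
    expand : ∀ x → x ≡ i * (a * x)
    expand x = trans (sym (*-identityˡ x)) (trans (cong (_* x) (sym ia≡1)) (*-assoc i a x))

  *≡0⇒≡0 : ∀ a {b} → a ≢ 0# → a * b ≡ 0# → b ≡ 0#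
  *≡0⇒≡0 a a≢0 eq = *-cancelˡ-≢0 a a≢0 (trans eq (sym (zeroʳ a)))

  -- The pivot step of every elimination below: `t` is `- b / a`.
  cancelling : ∀ {a} → a ≢ 0# → ∀ b → ∃[ t ] b + t * a ≡ 0#
  cancelling {a} a≢0 b with ≢0⇒invertible a≢0
  ... | i , ia≡1 = - (b * i) , (begin
    b + - (b * i) * a    ≡⟨ cong (b +_) (-‿distribˡ-* (b * i) a) ⟨
    b + - (b * i * a)    ≡⟨ cong (λ u → b + - u) (*-assoc b i a) ⟩
    b + - (b * (i * a))  ≡⟨ cong (λ u → b + - (b * u)) ia≡1 ⟩
    b + - (b * 1#)       ≡⟨ cong (λ u → b + - u) (*-identityʳ b) ⟩
    b + - b              ≡⟨ -‿inverseʳ b ⟩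
    0#                   ∎)

  +t*0 : ∀ a t {b} → b ≡ 0# → a + t * b ≡ a
  +t*0 a t refl = trans (cong (a +_) (zeroʳ t)) (+-identityʳ a)

  -- The dot product as a bilinear form

  _+[_]_ : Vec F n → F → Vec F n → Vec F n
  x +[ t ] y = zipWith _+_ x (Vec.map (t *_) y)

  lookup-+[] : (x : Vec F n) (t : F) (y : Vec F n) (i : Fin n) →
               lookup (x +[ t ] y) i ≡ lookup x i + t * lookup y i
  lookup-+[] x t y i = trans (lookup-zipWith _+_ i x _) (cong (lookup x i +_) (lookup-map i (t *_) y))

  ·-comm : (a x : Vec F n) → a · x ≡ x · a
  ·-comm []      []      = refl
  ·-comm (a ∷ v) (x ∷ w) = cong₂ _+_ (*-comm a x) (·-comm v w)

  ·-zeroʳ : (a : Vec F n) → a · replicate n 0# ≡ 0#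
  ·-zeroʳ []      = refl
  ·-zeroʳ (a ∷ v) = trans (cong₂ _+_ (zeroʳ a) (·-zeroʳ v)) (+-identityˡ 0#)

  ·-zeroˡ : (x : Vec F n) → replicate n 0# · x ≡ 0#
  ·-zeroˡ x = trans (·-comm (replicate _ 0#) x) (·-zeroʳ x)

  ·-+[]ʳ : (a x : Vec F n) (t : F) (y : Vec F n) → a · (x +[ t ] y) ≡ a · x + t * (a · y)
  ·-+[]ʳ []      []      t []      = sym (trans (+-identityˡ (t * 0#)) (zeroʳ t))
  ·-+[]ʳ (a ∷ v) (b ∷ x) t (c ∷ y) = trans (cong (a * (b + t * c) +_) (·-+[]ʳ v x t y))
    (solve 6 (λ a b t c X Y → a :* (b :+ t :* c) :+ (X :+ t :* Y) := a :* b :+ X :+ t :* (a :* c :+ Y))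
      refl a b t c (v · x) (v · y))

  ·-+[]ˡ : (x : Vec F n) (t : F) (y a : Vec F n) → (x +[ t ] y) · a ≡ x · a + t * (y · a)
  ·-+[]ˡ x t y a = begin
    (x +[ t ] y) · a        ≡⟨ ·-comm (x +[ t ] y) a ⟩
    a · (x +[ t ] y)        ≡⟨ ·-+[]ʳ a x t y ⟩
    a · x + t * (a · y)     ≡⟨ cong₂ (λ u v → u + t * v) (·-comm a x) (·-comm a y) ⟩
    x · a + t * (y · a)     ∎

  ·-*ʳ : (a : Vec F n) (t : F) (y : Vec F n) → a · Vec.map (t *_) y ≡ t * (a · y)
  ·-*ʳ []      t []      = sym (zeroʳ t)
  ·-*ʳ (a ∷ v) t (c ∷ y) = trans (cong (a * (t * c) +_) (·-*ʳ v t y))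
    (solve 4 (λ a t c Y → a :* (t :* c) :+ t :* Y := t :* (a :* c :+ Y)) refl a t c (v · y))

  ·-+ʳ : (a x y : Vec F n) → a · zipWith _+_ x y ≡ a · x + a · y
  ·-+ʳ []      []      []      = sym (+-identityˡ 0#)
  ·-+ʳ (a ∷ v) (b ∷ x) (c ∷ y) = trans (cong (a * (b + c) +_) (·-+ʳ v x y))
    (solve 5 (λ a b c X Y → a :* (b :+ c) :+ (X :+ Y) := a :* b :+ X :+ (a :* c :+ Y))
      refl a b c (v · x) (v · y))

  ·-cong : (a x b y : Vec F n) → (∀ i → lookup a i * lookup x i ≡ lookup b i * lookup y i) → a · x ≡ b · y
  ·-cong []      []      []      []      eq = refl
  ·-cong (_ ∷ a) (_ ∷ x) (_ ∷ b) (_ ∷ y) eq = cong₂ _+_ (eq zero) (·-cong a x b y λ i → eq (suc i))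

  ·-vanish : (a x : Vec F n) → (∀ i → lookup a i * lookup x i ≡ 0#) → a · x ≡ 0#
  ·-vanish []      []      eq = refl
  ·-vanish (_ ∷ a) (_ ∷ x) eq = trans (cong₂ _+_ (eq zero) (·-vanish a x λ i → eq (suc i))) (+-identityˡ 0#)

  ·-single : (a x : Vec F n) (j : Fin n) → (∀ i → i ≢ j → lookup a i * lookup x i ≡ 0#) →
             a · x ≡ lookup a j * lookup x j
  ·-single (a ∷ v) (x ∷ w) zero    eq = trans (cong (a * x +_) (·-vanish v w λ i → eq (suc i) λ ()))
    (+-identityʳ (a * x))
  ·-single (a ∷ v) (x ∷ w) (suc j) eq = trans (cong₂ _+_ (eq zero λ ())
    (·-single v w j λ i i≢j → eq (suc i) λ { refl → i≢j refl })) (+-identityˡ (lookup v j * lookup w j))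

  -- Linear combinations

  comb : Vec F m → Vec (Vec F n) m → Vec F n
  comb []      []      = replicate _ 0#
  comb (x ∷ v) (p ∷ P) = comb v P +[ x ] p

  -- Transposition: pulled back along `x ↦ comb x P`, a form becomes the vector of its values at the
  -- vectors of `P`.
  ·-comb : (a : Vec F n) (x : Vec F m) (P : Vec (Vec F n) m) → a · comb x P ≡ x · Vec.map (a ·_) P
  ·-comb a []      []      = ·-zeroʳ a
  ·-comb a (x ∷ v) (p ∷ P) = begin
    a · (comb v P +[ x ] p)            ≡⟨ ·-+[]ʳ a (comb v P) x p ⟩
    a · comb v P + x * (a · p)         ≡⟨ cong (_+ x * (a · p)) (·-comb a v P) ⟩
    v · Vec.map (a ·_) P + x * (a · p) ≡⟨ +-comm (v · Vec.map (a ·_) P) (x * (a · p)) ⟩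
    x * (a · p) + v · Vec.map (a ·_) P ∎

  -- `comb x P` is the product with `x` of the matrix whose columns are the vectors of `P`; this is
  -- the `j`-th row of that matrix.
  row : Vec (Vec F n) m → Fin n → Vec F m
  row P j = Vec.map (λ p → lookup p j) P

  lookup-comb : (x : Vec F m) (P : Vec (Vec F n) m) (j : Fin n) →
                lookup (comb x P) j ≡ row P j · x
  lookup-comb []      []      j = lookup-replicate j 0#
  lookup-comb (x ∷ v) (p ∷ P) j = begin
    lookup (comb v P +[ x ] p) j          ≡⟨ lookup-+[] (comb v P) x p j ⟩
    lookup (comb v P) j + x * lookup p j  ≡⟨ cong (_+ x * lookup p j) (lookup-comb v P j) ⟩
    V + x * lookup p j                    ≡⟨ +-comm V (x * lookup p j) ⟩
    x * lookup p j + V                    ≡⟨ cong (_+ V) (*-comm x (lookup p j)) ⟩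
    lookup p j * x + V                    ∎
    where V = row P j · v

  unit : Fin n → Vec F n
  unit zero    = 1# ∷ replicate _ 0#
  unit (suc i) = 0# ∷ unit i

  ·-unit : (a : Vec F n) (i : Fin n) → a · unit i ≡ lookup a i
  ·-unit (a ∷ v) zero    = trans (cong₂ _+_ (*-identityʳ a) (·-zeroʳ v)) (+-identityʳ a)
  ·-unit (a ∷ v) (suc i) = trans (cong₂ _+_ (zeroʳ a) (·-unit v i)) (+-identityˡ (lookup v i))

  -- Deciding inclusions between kernels

  ¬∃≢0⇒≡0 : {g : Fin n → F} → ¬ (∃[ i ] g i ≢ 0#) → ∀ i → g i ≡ 0#
  ¬∃≢0⇒≡0 {g = g} ¬∃ i = decidable-stable (g i ≟ 0#) λ gᵢ≢0 → ¬∃ (i , gᵢ≢0)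

  zero? : (a : Vec F n) → (∃[ x ] a · x ≢ 0#) ⊎ a ≡ replicate n 0#
  zero? a with any? (λ i → ¬? (lookup a i ≟ 0#))
  ... | yes (i , aᵢ≢0) = inj₁ (unit i , λ eq → aᵢ≢0 (trans (sym (·-unit a i)) eq))
  ... | no ¬∃ = inj₂ (vec-ext λ i → trans (¬∃≢0⇒≡0 ¬∃ i) (sym (lookup-replicate i 0#)))

  Ker : List (Vec F n) → Vec F n → Set
  Ker S x = All (λ a → a · x ≡ 0#) S

  Ker-+[] : (S : List (Vec F n)) {x p : Vec F n} (t : F) → Ker S x → Ker S p → Ker S (x +[ t ] p)
  Ker-+[] []      t []        []        = []
  Ker-+[] (h ∷ S) {x} {p} t (hx ∷ Sx) (hp ∷ Sp) =
    trans (·-+[]ʳ h x t p) (trans (+t*0 (h · x) t hp) hx) ∷ Ker-+[] S t Sx Sp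

  -- If h does not vanish at p ∈ Ker S, then Ker S = Ker (h ∷ S) ⊕ ⟨ p ⟩, and a
  -- can be changed by a multiple of h, without changing it on Ker (h ∷ S), so
  -- that it vanishes at p.
  vanishes-on-Ker? : (S : List (Vec F n)) (a : Vec F n) →
                     (∃[ p ] Ker S p × a · p ≢ 0#) ⊎ (∀ {x} → Ker S x → a · x ≡ 0#)
  vanishes-on-Ker? [] a with zero? a
  ... | inj₁ (p , ap≢0) = inj₁ (p , [] , ap≢0)
  ... | inj₂ refl       = inj₂ λ {x} _ → ·-zeroˡ x
  vanishes-on-Ker? (h ∷ S) a with vanishes-on-Ker? S h
  ... | inj₂ S⊆h with vanishes-on-Ker? S a
  ...   | inj₁ (p , Sp , ap≢0) = inj₁ (p , S⊆h Sp ∷ Sp , ap≢0)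
  ...   | inj₂ S⊆a             = inj₂ λ { (_ ∷ Sx) → S⊆a Sx }
  vanishes-on-Ker? (h ∷ S) a | inj₁ (p , Sp , hp≢0) with cancelling hp≢0 (a · p)
  ... | t , ap+thp≡0 with vanishes-on-Ker? S (a +[ t ] h)
  ...   | inj₂ S⊆b = inj₂ λ { {x} (hx ∷ Sx) →
            trans (sym (+t*0 (a · x) t hx)) (trans (sym (·-+[]ˡ a t h x)) (S⊆b Sx)) }
  ...   | inj₁ (q , Sq , bq≢0) with cancelling hp≢0 (h · q)
  -- Since `b` vanishes at `p`, moving `q` along `p` into the kernel of `h` leaves the value of `b`
  -- unchanged, and on that kernel `b` and `a` agree.
  ...     | s , hq+shp≡0 = inj₁ (q′ , hq′≡0 ∷ Ker-+[] S s Sq Sp , λ aq′≡0 → bq≢0 (begin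
    b · q                  ≡⟨ +t*0 (b · q) s (trans (·-+[]ˡ a t h p) ap+thp≡0) ⟨
    b · q + s * (b · p)    ≡⟨ ·-+[]ʳ b q s p ⟨
    b · q′                 ≡⟨ ·-+[]ˡ a t h q′ ⟩
    a · q′ + t * (h · q′)  ≡⟨ +t*0 (a · q′) t hq′≡0 ⟩
    a · q′                 ≡⟨ aq′≡0 ⟩
    0#                     ∎))
    where
    b  = a +[ t ] h
    q′ = q +[ s ] p
    hq′≡0 : h · q′ ≡ 0#
    hq′≡0 = trans (·-+[]ʳ h q s p) hq+shp≡0

  -- A point `p` with `b · p ≢ 0#` also has `a · p ≢ 0#`, so any `x` can be moved along `p` into the
  -- kernel of `a`, hence into that of `b`. If `b · x ≡ 0#`, the move must have been by zero.
  kernel-⊆⇒⊇ : (a b : Vec F n) → b ≢ replicate n 0# →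
               (∀ {x} → a · x ≡ 0# → b · x ≡ 0#) → ∀ {x} → b · x ≡ 0# → a · x ≡ 0#
  kernel-⊆⇒⊇ a b b≢0 a⊆b {x} bx≡0 with zero? b
  ... | inj₂ b≡0 = contradiction b≡0 b≢0
  ... | inj₁ (p , bp≢0) with cancelling (bp≢0 ∘ a⊆b) (a · x)
  ...   | t , ax+tap≡0 = begin
    a · x                ≡⟨ +t*0 (a · x) (a · p) t≡0 ⟨
    a · x + (a · p) * t  ≡⟨ cong (a · x +_) (*-comm (a · p) t) ⟩
    a · x + t * (a · p)  ≡⟨ ax+tap≡0 ⟩
    0#                   ∎
    where
    t≡0 : t ≡ 0#
    t≡0 = *≡0⇒≡0 (b · p) bp≢0 (begin
      (b · p) * t          ≡⟨ *-comm (b · p) t ⟩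
      t * (b · p)          ≡⟨ +-identityˡ (t * (b · p)) ⟨
      0# + t * (b · p)     ≡⟨ cong (_+ t * (b · p)) bx≡0 ⟨
      b · x + t * (b · p)  ≡⟨ ·-+[]ʳ b x t p ⟨
      b · (x +[ t ] p)     ≡⟨ a⊆b (trans (·-+[]ʳ a x t p) ax+tap≡0) ⟩
      0#                   ∎)

  -- Homogeneous linear systems

  ·-∷ : (r : Vec F (suc n)) (y : F) (x : Vec F n) → r · (y ∷ x) ≡ head r * y + tail r · x
  ·-∷ (_ ∷ _) y x = refl

  -- Gaussian elimination on the first unknown.
  underdetermined : (R : Fin m → Vec F (suc m)) →
                    ∃[ x ] (∃[ i ] lookup x i ≢ 0#) × (∀ j → R j · x ≡ 0#)
  underdetermined {m} R with any? (λ j → ¬? (head (R j) ≟ 0#))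
  -- No equation involves the first unknown, so it may be 1 and all others 0. A system without
  -- equations falls under this case, which therefore is the base of the recursion.
  ... | no ¬∃ = 1# ∷ replicate m 0# , (zero , 1≢0) , λ j → begin
    R j · (1# ∷ replicate m 0#)                    ≡⟨ ·-∷ (R j) 1# _ ⟩
    head (R j) * 1# + tail (R j) · replicate m 0#
      ≡⟨ cong₂ _+_ (cong (_* 1#) (¬∃≢0⇒≡0 ¬∃ j)) (·-zeroʳ (tail (R j))) ⟩
    0# * 1# + 0#                                   ≡⟨ trans (+-identityʳ (0# * 1#)) (zeroˡ 1#) ⟩
    0#                                             ∎
  underdetermined {suc m} R | yes (j , a≢0) = y ∷ x , (suc (proj₁ x≢0) , proj₂ x≢0) , solves
    where
    elim : ∀ i → ∃[ t ] head (R i) + t * head (R j) ≡ 0#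
    elim i = cancelling a≢0 (head (R i))

    rec = underdetermined λ i →
      tail (R (punchIn j i)) +[ proj₁ (elim (punchIn j i)) ] tail (R j)
    x   = proj₁ rec
    x≢0 = proj₁ (proj₂ rec)

    -- Back substitution: `y` is chosen so that the pivot equation `R j` holds.
    back = cancelling a≢0 (tail (R j) · x)
    y = proj₁ back

    pivot : head (R j) * y + tail (R j) · x ≡ 0#
    pivot = begin
      head (R j) * y + tail (R j) · x  ≡⟨ +-comm (head (R j) * y) (tail (R j) · x) ⟩
      tail (R j) · x + head (R j) * y  ≡⟨ cong (tail (R j) · x +_) (*-comm (head (R j)) y) ⟩
      tail (R j) · x + y * head (R j)  ≡⟨ proj₂ back ⟩
      0#                               ∎

    reduced : ∀ i → head (R (punchIn j i)) * y + tail (R (punchIn j i)) · x ≡ 0#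
    reduced i = begin
      b * y + s · x
        ≡⟨ +t*0 (b * y + s · x) t pivot ⟨
      b * y + s · x + t * (a * y + r · x)
        ≡⟨ solve 6 (λ b y s t a r →
             b :* y :+ s :+ t :* (a :* y :+ r) := (b :+ t :* a) :* y :+ (s :+ t :* r))
             refl b y (s · x) t a (r · x) ⟩
      (b + t * a) * y + (s · x + t * (r · x))
        ≡⟨ cong₂ (λ u v → u * y + v) (proj₂ (elim (punchIn j i)))
             (trans (sym (·-+[]ˡ s t r x)) (proj₂ (proj₂ rec) i)) ⟩
      0# * y + 0#
        ≡⟨ trans (+-identityʳ (0# * y)) (zeroˡ y) ⟩
      0# ∎
      where
      a = head (R j)
      r = tail (R j)
      b = head (R (punchIn j i))
      s = tail (R (punchIn j i))
      t = proj₁ (elim (punchIn j i))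

    solves : ∀ i → R i · (y ∷ x) ≡ 0#
    solves i with j Fin.≟ i
    ... | yes refl = trans (·-∷ (R j) y x) pivot
    ... | no j≢i   = trans (·-∷ (R i) y x)
      (subst (λ i → head (R i) * y + tail (R i) · x ≡ 0#) (punchIn-punchOut j≢i) (reduced (punchOut j≢i)))

  -- Linear maps given by their columns

  comb-+ : (P : Vec (Vec F n) m) (x y : Vec F m) →
           comb (zipWith _+_ x y) P ≡ zipWith _+_ (comb x P) (comb y P)
  comb-+ P x y = vec-ext λ j → begin
    lookup (comb (zipWith _+_ x y) P) j            ≡⟨ lookup-comb (zipWith _+_ x y) P j ⟩
    row P j · zipWith _+_ x y                      ≡⟨ ·-+ʳ (row P j) x y ⟩
    row P j · x + row P j · y                      ≡⟨ cong₂ _+_ (lookup-comb x P j) (lookup-comb y P j) ⟨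
    lookup (comb x P) j + lookup (comb y P) j      ≡⟨ lookup-zipWith _+_ j (comb x P) (comb y P) ⟨
    lookup (zipWith _+_ (comb x P) (comb y P)) j   ∎

  comb-* : (P : Vec (Vec F n) m) (t : F) (x : Vec F m) →
           comb (Vec.map (t *_) x) P ≡ Vec.map (t *_) (comb x P)
  comb-* P t x = vec-ext λ j → begin
    lookup (comb (Vec.map (t *_) x) P) j  ≡⟨ lookup-comb (Vec.map (t *_) x) P j ⟩
    row P j · Vec.map (t *_) x            ≡⟨ ·-*ʳ (row P j) t x ⟩
    t * (row P j · x)                     ≡⟨ cong (t *_) (lookup-comb x P j) ⟨
    t * lookup (comb x P) j               ≡⟨ lookup-map j (t *_) (comb x P) ⟨
    lookup (Vec.map (t *_) (comb x P)) j  ∎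

  comb-0 : (P : Vec (Vec F n) m) → comb (replicate m 0#) P ≡ replicate n 0#
  comb-0 P = vec-ext λ j → begin
    lookup (comb (replicate _ 0#) P) j  ≡⟨ lookup-comb (replicate _ 0#) P j ⟩
    row P j · replicate _ 0#            ≡⟨ ·-zeroʳ (row P j) ⟩
    0#                                  ≡⟨ lookup-replicate j 0# ⟨
    lookup (replicate _ 0#) j           ∎

  comb-neg : (P : Vec (Vec F n) m) (x : Vec F m) → comb (Vec.map -_ x) P ≡ Vec.map -_ (comb x P)
  comb-neg P x = begin
    comb (Vec.map -_ x) P             ≡⟨ cong (λ v → comb v P) (map-cong (sym ∘ -1*x≈-x) x) ⟩
    comb (Vec.map (- 1# *_) x) P      ≡⟨ comb-* P (- 1#) x ⟩
    Vec.map (- 1# *_) (comb x P)      ≡⟨ map-cong -1*x≈-x (comb x P) ⟩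
    Vec.map -_ (comb x P)             ∎

  -- The vector `y` and the `n` columns satisfy a nontrivial relation, being `suc n` vectors of
  -- length `n`. The coefficient `c` of `y` is nonzero, as otherwise injectivity would make the
  -- relation trivial; so the relation can be solved for `y`.
  injective⇒surjective : (P : Vec (Vec F n) n) →
                         (∀ x → comb x P ≡ replicate n 0# → ∀ i → lookup x i ≡ 0#) →
                         ∀ y → ∃[ x ] comb x P ≡ y
  injective⇒surjective {n} P kernel-0 y with underdetermined (row (y ∷ P))
  ... | c ∷ x , (i , cxᵢ≢0) , solves = Vec.map (t *_) x , (begin
    comb (Vec.map (t *_) x) P   ≡⟨ comb-* P t x ⟩
    Vec.map (t *_) (comb x P)   ≡⟨ vec-ext scaled ⟩
    y                           ∎)
    where
    relation : ∀ j → lookup (comb x P) j + c * lookup y j ≡ 0#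
    relation j = begin
      lookup (comb x P) j + c * lookup y j    ≡⟨ lookup-+[] (comb x P) c y j ⟨
      lookup (comb (c ∷ x) (y ∷ P)) j         ≡⟨ lookup-comb (c ∷ x) (y ∷ P) j ⟩
      row (y ∷ P) j · (c ∷ x)                 ≡⟨ solves j ⟩
      0#                                      ∎

    c≢0 : c ≢ 0#
    c≢0 refl = cxᵢ≢0 (cx≡0 i)
      where
      comb≡0 : comb x P ≡ replicate n 0#
      comb≡0 = vec-ext λ j → begin
        lookup (comb x P) j                      ≡⟨ +-identityʳ (lookup (comb x P) j) ⟨
        lookup (comb x P) j + 0#                 ≡⟨ cong (lookup (comb x P) j +_) (zeroˡ (lookup y j)) ⟨
        lookup (comb x P) j + 0# * lookup y j    ≡⟨ relation j ⟩
        0#                                       ≡⟨ lookup-replicate j 0# ⟨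
        lookup (replicate n 0#) j                ∎

      cx≡0 : ∀ i → lookup (0# ∷ x) i ≡ 0#
      cx≡0 zero    = refl
      cx≡0 (suc i) = kernel-0 x comb≡0 i

    -- This is `- 1 / c`.
    t = proj₁ (cancelling c≢0 1#)

    scaled : ∀ j → lookup (Vec.map (t *_) (comb x P)) j ≡ lookup y j
    scaled j = trans (lookup-map j (t *_) (comb x P)) (+-cancelʳ (t * (c * b)) (t * a) b (begin
      t * a + t * (c * b)  ≡⟨ distribˡ t a (c * b) ⟨
      t * (a + c * b)      ≡⟨ cong (t *_) (relation j) ⟩
      t * 0#               ≡⟨ zeroʳ t ⟩
      0#                   ≡⟨ zeroˡ b ⟨
      0# * b               ≡⟨ cong (_* b) (proj₂ (cancelling c≢0 1#)) ⟨
      (1# + t * c) * b     ≡⟨ distribʳ b 1# (t * c) ⟩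
      1# * b + t * c * b   ≡⟨ cong₂ _+_ (*-identityˡ b) (*-assoc t c b) ⟩
      b + t * (c * b)      ∎))
      where
      a = lookup (comb x P) j
      b = lookup y j

  -- Indicator vectors as linear forms

  indicator : Subset n → Vec F n
  indicator = Vec.map (λ b → if b then 1# else 0#)

  indicator-∈ : {I : Subset n} {i : Fin n} → i ∈ I → lookup (indicator I) i ≡ 1#
  indicator-∈ {I = I} {i} i∈I = trans (lookup-map i _ I) (cong (if_then 1# else 0#) ([]=⇒lookup i∈I))

  indicator-∉ : {I : Subset n} {i : Fin n} → i ∉ I → lookup (indicator I) i ≡ 0#
  indicator-∉ {I = I} {i} i∉I =
    trans (lookup-map i _ I) (cong (if_then 1# else 0#) (¬-not λ eq → i∉I (lookup⇒[]= i I eq)))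

  indicator·-single : {I : Subset n} {i : Fin n} (x : Vec F n) → i ∈ I →
                      (∀ j → j ≢ i → lookup x j ≡ 0#) → indicator I · x ≡ lookup x i
  indicator·-single {I = I} {i} x i∈I x≡0 = begin
    indicator I · x                      ≡⟨ ·-single (indicator I) x i off ⟩
    lookup (indicator I) i * lookup x i  ≡⟨ cong (_* lookup x i) (indicator-∈ i∈I) ⟩
    1# * lookup x i                      ≡⟨ *-identityˡ (lookup x i) ⟩
    lookup x i                           ∎
    where
    off : ∀ j → j ≢ i → lookup (indicator I) j * lookup x j ≡ 0#
    off j j≢i = trans (cong (lookup (indicator I) j *_) (x≡0 j j≢i)) (zeroʳ (lookup (indicator I) j))

  indicator·-vanish : (I : Subset n) (x : Vec F n) → (∀ {j} → j ∈ I → lookup x j ≡ 0#) →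
                      indicator I · x ≡ 0#
  indicator·-vanish I x x≡0 = ·-vanish (indicator I) x go
    where
    go : ∀ j → lookup (indicator I) j * lookup x j ≡ 0#
    go j with j ∈? I
    ... | yes j∈I = trans (cong (lookup (indicator I) j *_) (x≡0 j∈I)) (zeroʳ (lookup (indicator I) j))
    ... | no  j∉I = trans (cong (_* lookup x j) (indicator-∉ j∉I)) (zeroˡ (lookup x j))

  indicator⁅⁆· : (i : Fin n) (x : Vec F n) → indicator ⁅ i ⁆ · x ≡ lookup x i
  indicator⁅⁆· i x = begin
    indicator ⁅ i ⁆ · x                      ≡⟨ ·-single (indicator ⁅ i ⁆) x i off ⟩
    lookup (indicator ⁅ i ⁆) i * lookup x i  ≡⟨ cong (_* lookup x i) (indicator-∈ (x∈⁅x⁆ i)) ⟩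
    1# * lookup x i                          ≡⟨ *-identityˡ (lookup x i) ⟩
    lookup x i                               ∎
    where
    off : ∀ j → j ≢ i → lookup (indicator ⁅ i ⁆) j * lookup x j ≡ 0#
    off j j≢i = trans (cong (_* lookup x j) (indicator-∉ (j≢i ∘ x∈⁅y⁆⇒x≡y i))) (zeroˡ (lookup x j))

  -- Reconstructing a linear isomorphism from linear dependencies

  module Reconstruction
    {n} (Member : Subset n → Set) (member-⊤ : Member ⊤) (member-⁅⁆ : ∀ i → Member ⁅ i ⁆)
    (β : ∃ Member → Vec F n)
    -- Together, `α⇒β` and `β⇒α` say that the form at `I` lies in the span of the forms at `S` for
    -- one family exactly when it does for the other.
    (α⇒β : ∀ S I → (∀ {x} → Ker (map (indicator ∘ proj₁) S) x → indicator (proj₁ I) · x ≡ 0#) →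
                   ∀ {y} → Ker (map β S) y → β I · y ≡ 0#)
    (β⇒α : ∀ S I → (∀ {y} → Ker (map β S) y → β I · y ≡ 0#) →
                   ∀ {x} → Ker (map (indicator ∘ proj₁) S) x → indicator (proj₁ I) · x ≡ 0#)
    where

    α : ∃ Member → Vec F n
    α = indicator ∘ proj₁

    top : ∃ Member
    top = ⊤ , member-⊤

    single : Fin n → ∃ Member
    single i = ⁅ i ⁆ , member-⁅⁆ i

    singles : {P : Pred (Fin n) 0ℓ} → Decidable P → List (∃ Member)
    singles P? = map single (filter P? (allFin n))

    module _ {P : Pred (Fin n) 0ℓ} (P? : Decidable P) (γ : ∃ Member → Vec F n) {x : Vec F n} where

      Ker-singles⁺ : (∀ j → P j → γ (single j) · x ≡ 0#) → Ker (map γ (singles P?)) x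
      Ker-singles⁺ f = map⁺ (map⁺ (All.tabulate λ {j} j∈ →
        f j (proj₂ (∈-filter⁻ P? {xs = allFin n} j∈))))

      Ker-singles⁻ : Ker (map γ (singles P?)) x → ∀ j → P j → γ (single j) · x ≡ 0#
      Ker-singles⁻ k j Pj = All.lookup (map⁻ (map⁻ k)) (∈-filter⁺ P? (∈-allFin j) Pj)

    Ker-α-singles : {P : Pred (Fin n) 0ℓ} (P? : Decidable P) {x : Vec F n} →
                    Ker (map α (singles P?)) x → ∀ j → P j → lookup x j ≡ 0#
    Ker-α-singles P? {x} k j Pj = trans (sym (indicator⁅⁆· j x)) (Ker-singles⁻ P? α k j Pj)

    ≢? : (i : Fin n) → Decidable (_≢ i)
    ≢? i j = ¬? (j Fin.≟ i)

    others : Fin n → List (∃ Member)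
    others i = singles (≢? i)

    -- On the kernel of the `α` of `others i` only the `i`-th coordinate survives, and `α I` reads
    -- it off because `i` lies in `I`. So adding `α I` cuts the kernel down to zero, where every
    -- `α J` vanishes; `α⇒β` transfers this to `β`.
    β-determines : ∀ {i} I → i ∈ proj₁ I → ∀ J {y} →
                   Ker (map β (others i)) y → β I · y ≡ 0# → β J · y ≡ 0#
    β-determines {i} I i∈I J k βI·y≡0 = α⇒β (I ∷ others i) J α-determines (βI·y≡0 ∷ k)
      where
      α-determines : ∀ {x} → Ker (map α (I ∷ others i)) x → α J · x ≡ 0#
      α-determines {x} (αI·x≡0 ∷ k) = indicator·-vanish (proj₁ J) x λ {j} _ → vanish j
        where
        off : ∀ j → j ≢ i → lookup x j ≡ 0#
        off = Ker-α-singles (≢? i) k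
        vanish : ∀ j → lookup x j ≡ 0#
        vanish j with j Fin.≟ i
        ... | yes refl = trans (sym (indicator·-single x i∈I off)) αI·x≡0
        ... | no j≢i   = off j j≢i

    -- Otherwise `β (single i)` would depend on the `β` of `others i`, and by `β⇒α` the `i`-th
    -- coordinate would vanish wherever all the others do, which `unit i` refutes.
    dualVector : ∀ i → ∃[ q ] Ker (map β (others i)) q × β (single i) · q ≢ 0#
    dualVector i with vanishes-on-Ker? (map β (others i)) (β (single i))
    ... | inj₁ found = found
    ... | inj₂ S⊆βᵢ  = contradiction (begin
      1#                              ≡⟨ indicator-∈ (x∈⁅x⁆ i) ⟨
      lookup (indicator ⁅ i ⁆) i      ≡⟨ ·-unit (indicator ⁅ i ⁆) i ⟨
      indicator ⁅ i ⁆ · unit i        ≡⟨ β⇒α (others i) (single i) S⊆βᵢ (Ker-singles⁺ (≢? i) α λ j j≢i →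
        trans (·-unit (indicator ⁅ j ⁆) i) (indicator-∉ (j≢i ∘ sym ∘ x∈⁅y⁆⇒x≡y j))) ⟩
      0#                              ∎) 1≢0

    module _ (i : Fin n) where

      private
        q   = proj₁ (dualVector i)
        k-q = proj₁ (proj₂ (dualVector i))
        -- If `β top` vanished at `q`, then `β-determines` would make `β (single i)` vanish there
        -- too.
        inv = ≢0⇒invertible {β top · q} λ eq →
          proj₂ (proj₂ (dualVector i)) (β-determines top ∈⊤ (single i) k-q eq)

      p : Vec F n
      p = Vec.map (proj₁ inv *_) q

      top·p : β top · p ≡ 1#
      top·p = trans (·-*ʳ (β top) (proj₁ inv) q) (proj₂ inv)

      single·p : ∀ j → j ≢ i → β (single j) · p ≡ 0#
      single·p j j≢i = begin
        β (single j) · p                   ≡⟨ ·-*ʳ (β (single j)) (proj₁ inv) q ⟩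
        proj₁ inv * (β (single j) · q)     ≡⟨ cong (proj₁ inv *_) (Ker-singles⁻ (≢? i) β k-q j j≢i) ⟩
        proj₁ inv * 0#                     ≡⟨ zeroʳ (proj₁ inv) ⟩
        0#                                 ∎

      Ker-p : Ker (map β (others i)) p
      Ker-p = Ker-singles⁺ (≢? i) β single·p

      ∈⇒β·p≢0 : ∀ I → i ∈ proj₁ I → β I · p ≢ 0#
      ∈⇒β·p≢0 I i∈I eq = 1≢0 (trans (sym top·p) (β-determines I i∈I top Ker-p eq))

      -- All coordinates that enter `α I` are different from the `i`-th, so `α I` depends on the `α`
      -- of `others i`; the `β` of `others i` all vanish at `p`.
      ∉⇒β·p≡0 : ∀ I → i ∉ proj₁ I → β I · p ≡ 0#
      ∉⇒β·p≡0 I i∉I = α⇒β (others i) I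
        (λ {x} k → indicator·-vanish (proj₁ I) x λ {j} j∈I →
          Ker-α-singles (≢? i) k j λ { refl → i∉I j∈I })
        Ker-p

    β·p-constant : ∀ I {i j} → i ∈ proj₁ I → j ∈ proj₁ I → β I · p i ≡ β I · p j
    β·p-constant I {i} {j} i∈I j∈I = +-cancelʳ (- 1# * (β I · p j)) (β I · p i) (β I · p j) (begin
      β I · p i + - 1# * (β I · p j)  ≡⟨ ·-+[]ʳ (β I) (p i) (- 1#) (p j) ⟨
      β I · d                         ≡⟨ α⇒β (top ∷ singles ∉I?) I αI (top·d ∷ Ker-singles⁺ ∉I? β single·d) ⟩
      0#                              ≡⟨ x-x≡0 (β I · p j) ⟨
      β I · p j + - 1# * (β I · p j)  ∎)
      where
      d = p i +[ - 1# ] p j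

      x-x≡0 : ∀ x → x + - 1# * x ≡ 0#
      x-x≡0 x = trans (cong (x +_) (-1*x≈-x x)) (-‿inverseʳ x)

      ∉I? : Decidable (_∉ proj₁ I)
      ∉I? k = ¬? (k ∈? proj₁ I)

      -- The normalization of `p i` and `p j` to the same value of `β top` is used here.
      top·d : β top · d ≡ 0#
      top·d = begin
        β top · d                           ≡⟨ ·-+[]ʳ (β top) (p i) (- 1#) (p j) ⟩
        β top · p i + - 1# * (β top · p j)  ≡⟨ cong₂ (λ u v → u + - 1# * v) (top·p i) (top·p j) ⟩
        1# + - 1# * 1#                      ≡⟨ x-x≡0 1# ⟩
        0#                                  ∎

      single·d : ∀ k → k ∉ proj₁ I → β (single k) · d ≡ 0#
      single·d k k∉I = begin
        β (single k) · d                                  ≡⟨ ·-+[]ʳ (β (single k)) (p i) (- 1#) (p j) ⟩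
        β (single k) · p i + - 1# * (β (single k) · p j)
          ≡⟨ +t*0 (β (single k) · p i) (- 1#) (single·p j k λ { refl → k∉I j∈I }) ⟩
        β (single k) · p i                                ≡⟨ single·p i k (λ { refl → k∉I i∈I }) ⟩
        0#                                                ∎

      -- Where the coordinates outside `I` vanish, `α I` and `α top` are the same sum.
      αI : ∀ {x} → Ker (map α (top ∷ singles ∉I?)) x → α I · x ≡ 0#
      αI {x} (top·x≡0 ∷ k) = trans (·-cong (α I) x (α top) x same) top·x≡0
        where
        same : ∀ j → lookup (α I) j * lookup x j ≡ lookup (α top) j * lookup x j
        same j with j ∈? proj₁ I
        ... | yes j∈I = cong (_* lookup x j) (trans (indicator-∈ j∈I) (sym (indicator-∈ {I = ⊤} {j} ∈⊤)))
        ... | no  j∉I = begin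
          lookup (α I) j * lookup x j    ≡⟨ cong (lookup (α I) j *_) xⱼ≡0 ⟩
          lookup (α I) j * 0#            ≡⟨ zeroʳ (lookup (α I) j) ⟩
          0#                             ≡⟨ zeroʳ (lookup (α top) j) ⟨
          lookup (α top) j * 0#          ≡⟨ cong (lookup (α top) j *_) xⱼ≡0 ⟨
          lookup (α top) j * lookup x j  ∎
          where xⱼ≡0 = Ker-α-singles ∉I? k j j∉I

    basis : Vec (Vec F n) n
    basis = tabulate p

    lookup-β·basis : ∀ I i → lookup (Vec.map (β I ·_) basis) i ≡ β I · p i
    lookup-β·basis I i = trans (lookup-map i (β I ·_) basis) (cong (β I ·_) (lookup∘tabulate p i))

    -- The values of `β I` at the basis vectors are `β I · p i` on `I` and 0 off `I`, a multiple of
    -- the indicator of `I`; hence `β I` pulls back to that multiple of `α I`.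
    β·comb : ∀ I {i} → i ∈ proj₁ I → ∀ x → β I · comb x basis ≡ (β I · p i) * (α I · x)
    β·comb I {i} i∈I x = begin
      β I · comb x basis                           ≡⟨ ·-comb (β I) x basis ⟩
      x · Vec.map (β I ·_) basis                   ≡⟨ ·-cong x _ (α I) (Vec.map (c *_) x) terms ⟩
      α I · Vec.map (c *_) x                       ≡⟨ ·-*ʳ (α I) c x ⟩
      c * (α I · x)                                ∎
      where
      c = β I · p i

      value : ∀ k → β I · p k ≡ lookup (α I) k * c
      value k with k ∈? proj₁ I
      ... | yes k∈I = begin
        β I · p k           ≡⟨ β·p-constant I k∈I i∈I ⟩
        c                   ≡⟨ *-identityˡ c ⟨
        1# * c              ≡⟨ cong (_* c) (indicator-∈ k∈I) ⟨
        lookup (α I) k * c  ∎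
      ... | no k∉I = begin
        β I · p k           ≡⟨ ∉⇒β·p≡0 k I k∉I ⟩
        0#                  ≡⟨ zeroˡ c ⟨
        0# * c              ≡⟨ cong (_* c) (indicator-∉ k∉I) ⟨
        lookup (α I) k * c  ∎

      terms : ∀ k → lookup x k * lookup (Vec.map (β I ·_) basis) k ≡
                    lookup (α I) k * lookup (Vec.map (c *_) x) k
      terms k = begin
        lookup x k * lookup (Vec.map (β I ·_) basis) k    ≡⟨ cong (lookup x k *_) (lookup-β·basis I k) ⟩
        lookup x k * (β I · p k)                          ≡⟨ cong (lookup x k *_) (value k) ⟩
        lookup x k * (lookup (α I) k * c)
          ≡⟨ solve 3 (λ x a c → x :* (a :* c) := a :* (c :* x)) refl (lookup x k) (lookup (α I) k) c ⟩
        lookup (α I) k * (c * lookup x k)                 ≡⟨ cong (lookup (α I) k *_) (lookup-map k (c *_) x) ⟨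
        lookup (α I) k * lookup (Vec.map (c *_) x) k      ∎

    β·comb≡0⇒α≡0 : ∀ I {i} → i ∈ proj₁ I → ∀ x → β I · comb x basis ≡ 0# → α I · x ≡ 0#
    β·comb≡0⇒α≡0 I {i} i∈I x eq = *≡0⇒≡0 (β I · p i) (∈⇒β·p≢0 i I i∈I) (trans (sym (β·comb I i∈I x)) eq)

    α≡0⇒β·comb≡0 : ∀ I {i} → i ∈ proj₁ I → ∀ x → α I · x ≡ 0# → β I · comb x basis ≡ 0#
    α≡0⇒β·comb≡0 I {i} i∈I x eq =
      trans (β·comb I i∈I x) (trans (cong (β I · p i *_) eq) (zeroʳ (β I · p i)))

    lookup-comb-basis : ∀ x j → β (single j) · comb x basis ≡ (β (single j) · p j) * lookup x j
    lookup-comb-basis x j =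
      trans (β·comb (single j) (x∈⁅x⁆ j) x) (cong (β (single j) · p j *_) (indicator⁅⁆· j x))

    -- `β (single j)` recovers the `j`-th coefficient up to a nonzero factor.
    comb-injective : ∀ {x y} → comb x basis ≡ comb y basis → x ≡ y
    comb-injective {x} {y} eq = vec-ext λ j →
      *-cancelˡ-≢0 (β (single j) · p j) (∈⇒β·p≢0 j (single j) (x∈⁅x⁆ j)) (begin
        (β (single j) · p j) * lookup x j  ≡⟨ lookup-comb-basis x j ⟨
        β (single j) · comb x basis        ≡⟨ cong (β (single j) ·_) eq ⟩
        β (single j) · comb y basis        ≡⟨ lookup-comb-basis y j ⟩
        (β (single j) · p j) * lookup y j  ∎)

    comb-surjective : ∀ y → ∃[ x ] comb x basis ≡ y
    comb-surjective = injective⇒surjective basis λ x x↦0 i → begin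
      lookup x i                 ≡⟨ cong (λ v → lookup v i)
                                      (comb-injective {x} {replicate n 0#} (trans x↦0 (sym (comb-0 basis)))) ⟩
      lookup (replicate n 0#) i  ≡⟨ lookup-replicate i 0# ⟩
      0#                         ∎

-- Specialization to hyperplanes over the rationals

ℚ-discreteField : DiscreteField
ℚ-discreteField = record
  { F                 = ℚ
  ; _+_               = ℚ._+_
  ; _*_               = ℚ._*_
  ; -_                = ℚ.-_
  ; 0#                = ℚ.0ℚ
  ; 1#                = ℚ.1ℚ
  ; isCommutativeRing = ℚ.+-*-isCommutativeRing
  ; _≟_               = ℚ._≟_
  ; 1≢0               = ℚ.1≢0
  ; ≢0⇒invertible     = λ {a} a≢0 → let instance _ = ℚ.≢-nonZero a≢0 in ℚ.1/ a , ℚ.*-inverseˡ a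
  }

open LinearAlgebra ℚ-discreteField using
  (Ker; comb; comb-+; comb-*; comb-0; comb-neg; zero?; kernel-⊆⇒⊇; module Reconstruction)
open Hyperplane using (normal; normal≢0)

-- Hyperplanes are never properly nested; this lets atoms of `L` be identified by inclusions in one
-- direction.
⟦⟧-⊆⇒⊇ : ∀ {n} (K K′ : Hyperplane n) → ⟦ K ⟧ ⊆ ⟦ K′ ⟧ → ⟦ K′ ⟧ ⊆ ⟦ K ⟧
⟦⟧-⊆⇒⊇ K K′ = kernel-⊆⇒⊇ (normal K) (normal K′) (normal≢0 K′)

⟦⟧-proper : ∀ {n} (K : Hyperplane n) → ¬ (∀ {x} → ⟦ K ⟧ x)
⟦⟧-proper K K-full with zero? (normal K)
... | inj₁ (x , Kx≢0) = Kx≢0 K-full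
... | inj₂ K≡0        = normal≢0 K K≡0

-- Arrangements with isomorphic intersection lattices

module Isomorphic {n} (C A : Arrangement n) (iso : L C ≅ L A) where

  private
    f = proj₁ iso
    open IsOrderIsomorphism (proj₂ iso) using (mono; cancel; surjective)

  -- The order of `L` is reverse inclusion, so the two flats change places here and in `cancel-⊆`.
  mono-⊆ : (X Y : Flat C) → points X ⊆ points Y → points (f X) ⊆ points (f Y)
  mono-⊆ X Y = mono {Y} {X}

  cancel-⊆ : (X Y : Flat C) → points (f X) ⊆ points (f Y) → points X ⊆ points Y
  cancel-⊆ X Y = cancel {Y} {X}

  preimage : (Z : Flat A) → ∃[ X ] points (f X) ≐ points Z
  preimage Z with surjective Z
  ... | X , f≈ = X , f≈ ((λ x → x) , (λ x → x))

  flat : ∀ {B : Arrangement n} {K} → K ∈ˡ B → Flat B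
  flat {K = K} K∈B = K ∷ [] , λ { (here refl) → K∈B }

  whole : ∀ {B : Arrangement n} → Flat B
  whole = [] , λ ()

  -- The whole space is the least element of both lattices.
  f-whole : ∀ {x} → points (f whole) x
  f-whole with preimage whole
  ... | X , _ , whole⊆fX = mono-⊆ X whole (λ _ → []) (whole⊆fX [])

  Corresponds : ∀ {K} → K ∈ˡ C → Hyperplane n → Set
  Corresponds K∈C H = points (f (flat K∈C)) ≐ ⟦ H ⟧

  -- If the image of `X` lies in a hyperplane, `X` is not the whole space, so its list has a first
  -- member. That member need not correspond to `H`.
  below-hyperplane : (X : Flat C) (H : Hyperplane n) → points (f X) ⊆ ⟦ H ⟧ →
                     ∃[ K ] K ∈ˡ C × points X ⊆ ⟦ K ⟧
  below-hyperplane X@([] , _) H fX⊆H =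
    contradiction (λ {x} → fX⊆H {x} (mono-⊆ whole X (λ _ → []) f-whole)) (⟦⟧-proper H)
  below-hyperplane (K ∷ S , sub) H _ = K , sub (here refl) , All.head

  -- Let `H` be the first hyperplane in a list presenting the image of `K`, and `Y` the flat sent to
  -- `H`. Then `K` lies in `Y`, and `Y` lies in some `K′` of `C`. Since hyperplanes are not properly
  -- nested, `Y` equals `K`, and so `H` is the whole image.
  atom-image : ∀ {K} (K∈C : K ∈ˡ C) → ∃[ H ] H ∈ˡ A × Corresponds K∈C H
  -- The image is replaced by a variable flat `Z` with the same points, so that its list can be
  -- split into cases.
  atom-image {K} K∈C = go (f (flat K∈C)) (λ x → x) (λ x → x)
    where
    go : (Z : Flat A) → points (f (flat K∈C)) ⊆ points Z → points Z ⊆ points (f (flat K∈C)) →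
         ∃[ H ] H ∈ˡ A × Corresponds K∈C H
    go ([] , _) _ Z⊆fK =
      contradiction (λ {x} → All.head (cancel-⊆ whole (flat K∈C) (λ _ → Z⊆fK []) {x} [])) (⟦⟧-proper K)
    go (H ∷ S , sub) fK⊆Z _ with preimage (flat (sub (here refl)))
    ... | Y , fY⊆H , H⊆fY with below-hyperplane Y H (All.head ∘ fY⊆H)
    ...   | K′ , _ , Y⊆K′ = H , sub (here refl) , fK⊆H , λ Hx → mono-⊆ Y (flat K∈C) Y⊆K (H⊆fY (Hx ∷ []))
      where
      fK⊆H : points (f (flat K∈C)) ⊆ ⟦ H ⟧
      fK⊆H = All.head ∘ fK⊆Z
      K⊆Y : points (flat K∈C) ⊆ points Y
      K⊆Y = cancel-⊆ (flat K∈C) Y λ x → H⊆fY (fK⊆H x ∷ [])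
      Y⊆K : points Y ⊆ points (flat K∈C)
      Y⊆K y = ⟦⟧-⊆⇒⊇ K K′ (λ Kx → Y⊆K′ (K⊆Y (Kx ∷ []))) (Y⊆K′ y) ∷ []

  -- The flat `Y` sent to `H` lies in some `K` of `C`, so `H` lies in the image of `K`, which by
  -- `atom-image` is a hyperplane `H′`; then `H` and `H′` coincide.
  atom-preimage : ∀ {H} → H ∈ˡ A → ∃[ K ] Σ (K ∈ˡ C) λ K∈C → Corresponds K∈C H
  atom-preimage {H} H∈A with preimage (flat H∈A)
  ... | Y , fY⊆H , H⊆fY with below-hyperplane Y H (All.head ∘ fY⊆H)
  ...   | K , K∈C , Y⊆K with atom-image K∈C
  ...     | H′ , _ , fK⊆H′ , H′⊆fK = K , K∈C , ⟦⟧-⊆⇒⊇ H H′ H⊆H′ ∘ fK⊆H′ , H⊆fK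
    where
    H⊆fK : ⟦ H ⟧ ⊆ points (f (flat K∈C))
    H⊆fK Hx = mono-⊆ Y (flat K∈C) (λ y → Y⊆K y ∷ []) (H⊆fY (Hx ∷ []))
    H⊆H′ : ⟦ H ⟧ ⊆ ⟦ H′ ⟧
    H⊆H′ = fK⊆H′ ∘ H⊆fK

  corresponds-unique : ∀ {K K′} H (K∈C : K ∈ˡ C) (K′∈C : K′ ∈ˡ C) →
                       Corresponds K∈C H → Corresponds K′∈C H → ⟦ K ⟧ ⊆ ⟦ K′ ⟧
  corresponds-unique _ K∈C K′∈C (fK⊆H , _) (_ , H⊆fK′) Kx =
    All.head (cancel-⊆ (flat K∈C) (flat K′∈C) (H⊆fK′ ∘ fK⊆H) (Kx ∷ []))

  -- Intersections are joins in L, hence are determined by the order.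
  module _ {T : Set} (c a : T → Hyperplane n) (c∈ : ∀ t → c t ∈ˡ C) (a∈ : ∀ t → a t ∈ˡ A)
           (c~a : ∀ t → Corresponds (c∈ t) (a t)) where

    private
      join : ∀ {B} (b : T → Hyperplane n) → (∀ t → b t ∈ˡ B) → List T → Flat B
      join b b∈ S = map b S , λ H∈ → let t , _ , H≡bt = ∈-map⁻ b H∈ in subst (_∈ˡ _) (sym H≡bt) (b∈ t)

      f-join⊆ : ∀ S → points (f (join c c∈ S)) ⊆ ⋂ (map a S)
      f-join⊆ S x = map⁺ (All.tabulate λ {t} t∈S →
        proj₁ (c~a t) (mono-⊆ (join c c∈ S) (flat (c∈ t)) (λ Sx → All.lookup (map⁻ Sx) t∈S ∷ []) x))

      -- The flat `Y` sent to the intersection of the `a t` lies in every `c t`, since `f` reflects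
      -- inclusions; hence `Y` lies in their intersection.
      f-join⊇ : ∀ S → ⋂ (map a S) ⊆ points (f (join c c∈ S))
      f-join⊇ S x with preimage (join a a∈ S)
      ... | Y , fY⊆S , S⊆fY = mono-⊆ Y (join c c∈ S)
        (λ y → map⁺ (All.tabulate λ {t} t∈S → All.head (cancel-⊆ Y (flat (c∈ t))
          (λ fy → proj₂ (c~a t) (All.lookup (map⁻ (fY⊆S fy)) t∈S)) y)))
        (S⊆fY x)

    dependence⁺ : ∀ S t → ⋂ (map c S) ⊆ ⟦ c t ⟧ → ⋂ (map a S) ⊆ ⟦ a t ⟧
    dependence⁺ S t S⊆ x = proj₁ (c~a t)
      (mono-⊆ (join c c∈ S) (flat (c∈ t)) (λ Sx → S⊆ Sx ∷ []) (f-join⊇ S x))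

    dependence⁻ : ∀ S t → ⋂ (map a S) ⊆ ⟦ a t ⟧ → ⋂ (map c S) ⊆ ⟦ c t ⟧
    dependence⁻ S t S⊆ x = All.head
      (cancel-⊆ (join c c∈ S) (flat (c∈ t)) (λ fx → proj₂ (c~a t) (S⊆ (f-join⊆ S fx))) x)

-- Connected subgraph arrangements

⁅⁆-connected : ∀ {n} (G : Graph (Fin n)) i → Connected (G [ ⁅ i ⁆ ])
⁅⁆-connected G i = (i , x∈⁅x⁆ i) , λ u v →
  walk u v (trans (x∈⁅y⁆⇒x≡y i (proj₂ u)) (sym (x∈⁅y⁆⇒x≡y i (proj₂ v))))
  where
  walk : ∀ u v → proj₁ u ≡ proj₁ v → Star (Graph._~_ (G [ ⁅ i ⁆ ])) u v
  walk (u , p) (_ , q) refl with []=-irrelevant p q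
  ... | refl = ε

-- `G [ ⊤ ]` is `G` with membership proofs attached; walks are lifted with `∈⊤`, and the proofs at
-- the endpoints are then exchanged.
⊤-connected : ∀ {n} (G : Graph (Fin n)) → Connected G → Connected (G [ ⊤ ])
⊤-connected G (v , walk) = (v , ∈⊤) , λ (u , p) (w , q) →
  subst₂ (λ p q → Star (Graph._~_ (G [ ⊤ ])) (u , p) (w , q)) ([]=-irrelevant ∈⊤ p) ([]=-irrelevant ∈⊤ q)
    (gmap (_, ∈⊤) (λ e → e) (walk u w))

-- The conditions are the same, but one list holds hyperplanes and the other their normals. This and
-- `Ker⇒⋂` connect flats to the linear algebra.
⋂⇒Ker : ∀ {T : Set} {n} (b : T → Hyperplane n) S → ⋂ (map b S) ⊆ Ker (map (normal ∘ b) S)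
⋂⇒Ker b []      []         = []
⋂⇒Ker b (t ∷ S) (bx ∷ Sx) = bx ∷ ⋂⇒Ker b S Sx

Ker⇒⋂ : ∀ {T : Set} {n} (b : T → Hyperplane n) S → Ker (map (normal ∘ b) S) ⊆ ⋂ (map b S)
Ker⇒⋂ b []      []         = []
Ker⇒⋂ b (t ∷ S) (bx ∷ Sx) = bx ∷ Ker⇒⋂ b S Sx

comb-GL : ∀ {n} (P : Vec (Vec ℚ n) n) → (∀ {x y} → comb x P ≡ comb y P → x ≡ y) →
          (∀ y → ∃[ x ] comb x P ≡ y) → GL n
comb-GL P injective surjective = (λ x → comb x P) , record
  { isLeftModuleMonomorphism = record
    { isLeftModuleHomomorphism = record
      { +ᴹ-isGroupHomomorphism = record
        { isMonoidHomomorphism = record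
          { isMagmaHomomorphism = record
            { isRelHomomorphism = record { cong = cong (λ x → comb x P) }
            ; homo              = comb-+ P
            }
          ; ε-homo = comb-0 P
          }
        ; ⁻¹-homo = comb-neg P
        }
      ; *ₗ-homo = comb-* P
      }
    ; injective = injective
    }
  ; surjective = λ y → proj₁ (surjective y) , λ { refl → proj₂ (surjective y) }
  }

-- Projective uniqueness from the matching of hyperplanes

module _ {n} (G : Graph (Fin n)) (G-connected : Connected G) where

  ConnectedSubset : Set
  ConnectedSubset = ∃ λ I → Connected (G [ I ])

  hyperplane : ConnectedSubset → Hyperplane n
  hyperplane (I , I-connected) = H I (proj₁ I-connected)

  -- The lattice isomorphism has been reduced to agreement of dependencies; `Reconstruction`,
  -- applied to the normals of the `K I`, supplies the linear map.
  realize : (K : ConnectedSubset → Hyperplane n) →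
            (∀ S I → ⋂ (map hyperplane S) ⊆ ⟦ hyperplane I ⟧ → ⋂ (map K S) ⊆ ⟦ K I ⟧) →
            (∀ S I → ⋂ (map K S) ⊆ ⟦ K I ⟧ → ⋂ (map hyperplane S) ⊆ ⟦ hyperplane I ⟧) →
            Σ (GL n) λ φ → ∀ I → ⟦ K I ⟧ ≐ image φ ⟦ hyperplane I ⟧
  realize K H⇒K K⇒H = comb-GL basis comb-injective comb-surjective , λ I → to I , from I
    where
    α⇒β : ∀ S I → Ker (map (normal ∘ hyperplane) S) ⊆ ⟦ hyperplane I ⟧ →
          Ker (map (normal ∘ K) S) ⊆ ⟦ K I ⟧
    α⇒β S I S⊆ {x} Kx =
      H⇒K S I (λ {y} Hy → S⊆ (⋂⇒Ker hyperplane S {y} Hy)) {x} (Ker⇒⋂ K S Kx)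

    β⇒α : ∀ S I → Ker (map (normal ∘ K) S) ⊆ ⟦ K I ⟧ →
          Ker (map (normal ∘ hyperplane) S) ⊆ ⟦ hyperplane I ⟧
    β⇒α S I S⊆ {x} Hx =
      K⇒H S I (λ {y} Ky → S⊆ (⋂⇒Ker K S {y} Ky)) {x} (Ker⇒⋂ hyperplane S Hx)

    -- Connectedness of `G` enters here: it makes the full vertex set a member, so that `β top` is
    -- available for the normalization.
    open Reconstruction (λ I → Connected (G [ I ])) (⊤-connected G G-connected) (⁅⁆-connected G)
      (normal ∘ K) α⇒β β⇒α using (basis; comb-injective; comb-surjective; β·comb≡0⇒α≡0; α≡0⇒β·comb≡0)

    to : ∀ I {y} → ⟦ K I ⟧ y → ∃[ x ] ⟦ hyperplane I ⟧ x × comb x basis ≡ y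
    to I@(_ , (_ , i∈I) , _) {y} Ky =
      let x , φx≡y = comb-surjective y in
      x , β·comb≡0⇒α≡0 I i∈I x (subst ⟦ K I ⟧ (sym φx≡y) Ky) , φx≡y

    from : ∀ I {y} → (∃[ x ] ⟦ hyperplane I ⟧ x × comb x basis ≡ y) → ⟦ K I ⟧ y
    from I@(_ , (_ , i∈I) , _) (x , Hx , φx≡y) = subst ⟦ K I ⟧ φx≡y (α≡0⇒β·comb≡0 I i∈I x Hx)

  module _ (C : Arrangement n) (iso : L C ≅ L (𝒜 G)) where

    open Isomorphic C (𝒜 G) iso

    hyperplane∈𝒜 : ∀ I → hyperplane I ∈ˡ 𝒜 G
    hyperplane∈𝒜 (I , I-connected) = 𝒜-complete G I (proj₁ I-connected) I-connected

    isImage : (K : ConnectedSubset → Hyperplane n) (K∈ : ∀ I → K I ∈ˡ C) →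
              (∀ I → Corresponds (K∈ I) (hyperplane I)) →
              (φ : GL n) → (∀ I → ⟦ K I ⟧ ≐ image φ ⟦ hyperplane I ⟧) → C IsImageOf 𝒜 G Under φ
    isImage K K∈ K~H φ K≐φH = All.tabulate from-C , All.tabulate from-A
      where
      from-C : ∀ {K₀} → K₀ ∈ˡ C → ∃[ H₀ ] H₀ ∈ˡ 𝒜 G × ⟦ K₀ ⟧ ≐ image φ ⟦ H₀ ⟧
      -- `K₀` and the chosen `K t` correspond to the same hyperplane of `𝒜 G`, so they have the same
      -- points.
      from-C K₀∈C with atom-image K₀∈C
      ... | H₀ , H₀∈A , fK₀≐H₀ with 𝒜-sound G H₀∈A
      ...   | I , I≠∅ , I-connected , refl =
        H I I≠∅ , H₀∈A , proj₁ (K≐φH t) ∘ corresponds-unique (hyperplane t) K₀∈C (K∈ t) fK₀≐H₀ (K~H t) ,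
        corresponds-unique (hyperplane t) (K∈ t) K₀∈C (K~H t) fK₀≐H₀ ∘ proj₂ (K≐φH t)
        where
        t = I , I-connected

      from-A : ∀ {H₀} → H₀ ∈ˡ 𝒜 G → ∃[ K₀ ] K₀ ∈ˡ C × ⟦ K₀ ⟧ ≐ image φ ⟦ H₀ ⟧
      from-A H₀∈A with 𝒜-sound G H₀∈A
      ... | I , I≠∅ , I-connected , refl = K t , K∈ t , K≐φH t
        where
        t = I , I-connected

    match⇒image : (∀ I → ∃[ K ] Σ (K ∈ˡ C) λ K∈C → Corresponds K∈C (hyperplane I)) →
               Σ (GL n) λ φ → C IsImageOf 𝒜 G Under φ
    match⇒image match = proj₁ realization , isImage K K∈ K~H (proj₁ realization) (proj₂ realization)
      where
      K : ConnectedSubset → Hyperplane n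
      K I = proj₁ (match I)
      K∈ : ∀ I → K I ∈ˡ C
      K∈ I = proj₁ (proj₂ (match I))
      K~H : ∀ I → Corresponds (K∈ I) (hyperplane I)
      K~H I = proj₂ (proj₂ (match I))
      realization : Σ (GL n) λ φ → ∀ I → ⟦ K I ⟧ ≐ image φ ⟦ hyperplane I ⟧
      realization = realize K
        (dependence⁻ K hyperplane K∈ hyperplane∈𝒜 K~H)
        (dependence⁺ K hyperplane K∈ hyperplane∈𝒜 K~H)

mainTheorem1 : (n : ℕ) (G : Graph (Fin n)) → Connected G → ProjectivelyUnique (𝒜 G)
mainTheorem1 n G G-connected C iso =
  match⇒image G G-connected C iso λ I →
    Isomorphic.atom-preimage C (𝒜 G) iso (hyperplane∈𝒜 G G-connected C iso I)
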